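{- If $\alpha\in(0,1)\setminus\mathbb{Q}$ is a root of a quadratic equation with integer coefficients, then $$\lim_{N\to\infty} \frac{\#\{1\le n\le N : \#\Delta_n(\alpha)=2\}}{N} = 0.$$
   Context: For $x\in\mathbb{R}$, $\langle x\rangle = x \bmod 1$ denotes the fractional part. For $\alpha\in(0,1)\setminus\mathbb{Q}$ and $n\in\mathbb{N}$, let $P_n(\alpha)=\{\langle 0\alpha\rangle,\langle 1\alpha\rangle,\dots,\langle (n-1)\alpha\rangle, 1\}\subset[0,1]$. Arranging these points in increasing order, the lengths of the gaps between consecutive points form the set $\Delta_n(\alpha)$ of gap lengths, and $\#\Delta_n(\alpha)$ denotes the number of distinct gap lengths (so repeated lengths are counted once). -}

module Defs where

open import Data.Bool using (Bool; true; false; _∧_; _∨_; not; if_then_else_)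
open import Data.Nat as ℕ using (ℕ; zero; suc)
open import Data.Integer as ℤ using (ℤ; +_; _≤ᵇ_; _<_)
open import Data.Integer.Properties using () renaming (_≟_ to _≟ℤ_)
open import Data.Sign using (Sign)
open import Data.Product using (_×_; _,_)
open import Data.Product.Properties using (≡-dec)
open import Data.List using (List; []; _∷_; [_]; _++_; map; length; filter; upTo; deduplicate)
open import Relation.Binary.PropositionalEquality using (_≡_; _≢_)
open import Relation.Nullary.Decidable using (T?)

-- A real quadratic irrational α, given as a root of a·X² + b·X + c = 0
-- (a, b, c ∈ ℤ, a ≠ 0) with discriminant D = b² − 4ac > 0 not a perfect
-- square (so the roots are real and irrational).  The root is selected by
-- a sign ε:  α = (−b + ε √D) / (2a).

disc : ℤ → ℤ → ℤ → ℤ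
disc a b c = b ℤ.* b ℤ.- (+ 4) ℤ.* a ℤ.* c

signℤ : Sign → ℤ
signℤ Sign.+ = + 1
signℤ Sign.- = ℤ.- (+ 1)

infix 4 _≤?ᵇ_ _<?ᵇ_

_≤?ᵇ_ : ℤ → ℤ → Bool
x ≤?ᵇ y = x ≤ᵇ y

_<?ᵇ_ : ℤ → ℤ → Bool
x <?ᵇ y = not (y ≤ᵇ x)

-- posD D x y = true  iff  x + y·√D > 0   (for D > 0 not a perfect square)
posD : ℤ → ℤ → ℤ → Bool
posD D x y =
     ((+ 0 ≤?ᵇ x) ∧ (+ 0 ≤?ᵇ y) ∧ ((+ 0 <?ᵇ x) ∨ (+ 0 <?ᵇ y)))
  ∨ ((+ 0 <?ᵇ x) ∧ (y <?ᵇ + 0) ∧ ((y ℤ.* y ℤ.* D) <?ᵇ (x ℤ.* x)))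
  ∨ ((x <?ᵇ + 0) ∧ (+ 0 <?ᵇ y) ∧ ((x ℤ.* x) <?ᵇ (y ℤ.* y ℤ.* D)))

-- Elements of ℤ + ℤα are represented by pairs (j , m) standing for j·α + m.
-- Since α is irrational this representation is faithful (injective).
Lin : Set
Lin = ℤ × ℤ

record QuadIrr : Set where
  field
    a b c : ℤ
    ε     : Sign
  D : ℤ
  D = disc a b c

  -- j·α + m = (2am − jb + εj √D) / (2a);  its sign is that of a·(…)
  pos : Lin → Bool
  pos (j , m) = posD D (a ℤ.* ((+ 2) ℤ.* a ℤ.* m ℤ.- j ℤ.* b))
                       (a ℤ.* (signℤ ε ℤ.* j))

  _<ᴸ_ : Lin → Lin → Bool
  (j , m) <ᴸ (j' , m') = pos (j' ℤ.- j , m' ℤ.- m)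

  _≤ᴸ_ : Lin → Lin → Bool
  u ≤ᴸ v = not (v <ᴸ u)

record IsQuadIrrIn01 (α : QuadIrr) : Set where
  open QuadIrr α
  field
    a≢0        : a ≢ + 0
    D>0        : + 0 < D
    D-nonsq    : ∀ (t : ℤ) → t ℤ.* t ≢ D
    α>0        : pos (+ 1 , + 0) ≡ true
    α<1        : pos (ℤ.- (+ 1) , + 1) ≡ true

module _ (α : QuadIrr) where
  open QuadIrr α

  -- ⌊kα⌋ for k ∈ ℕ (α ∈ (0,1)) : the number of m ∈ {1,…,k} with m ≤ kα
  floorMul : ℕ → ℕ
  floorMul k = length (filter (λ m → T? ((+ 0 , + m) ≤ᴸ (+ k , + 0)))
                              (map suc (upTo k)))

  frac : ℕ → Lin
  frac k = (+ k , ℤ.- (+ floorMul k))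

  points : ℕ → List Lin
  points n = map frac (upTo n) ++ [ (+ 0 , + 1) ]

  insert : Lin → List Lin → List Lin
  insert x [] = x ∷ []
  insert x (y ∷ ys) = if x ≤ᴸ y then x ∷ y ∷ ys else y ∷ insert x ys

  sort : List Lin → List Lin
  sort [] = []
  sort (x ∷ xs) = insert x (sort xs)

  gapsOf : List Lin → List Lin
  gapsOf [] = []
  gapsOf (x ∷ []) = []
  gapsOf ((j , m) ∷ (j' , m') ∷ ys) = (j' ℤ.- j , m' ℤ.- m) ∷ gapsOf ((j' , m') ∷ ys)

  Δ : ℕ → List Lin
  Δ n = deduplicate (≡-dec _≟ℤ_ _≟ℤ_) (gapsOf (sort (points n)))

  #Δ : ℕ → ℕ
  #Δ n = length (Δ n)

  twoGapCount : ℕ → ℕ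
  twoGapCount N = length (filter (λ n → #Δ n ℕ.≟ 2) (map suc (upTo N)))

{-# OPTIONS --safe #-}
module Submission where

-- Let ⟨pα⟩ be the smallest and ⟨qα⟩ the largest of the numbers ⟨iα⟩ with 0 < i < n.
-- If only two gap lengths occur they are ⟨pα⟩ and 1 − ⟨qα⟩, and looking at the gap to the
-- right of ⟨(q−1)α⟩ one finds n = p + q.  When n grows to a later two-gap value n′ = p′ + q′,
-- either index is unchanged or jumps to at least n, so n′ ≥ n + min(p′, q′).  By the
-- Archimedean property both indices tend to infinity with n.  Hence the distances between
-- consecutive two-gap values tend to infinity, and these values have density zero.

open import Defs
open import Data.Bool using (true; false; not; T)
open import Data.Bool.Properties using (∨-identityʳ)
open import Data.Empty using (⊥; ⊥-elim)
open import Data.Integer using (ℤ; +_; -[1+_]; +[1+_]; _+_; _*_; -_; _-_; _≤_; _<_; _≤ᵇ_; ∣_∣; +<+; +≤+)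
open import Data.Integer.Properties
open import Data.Integer.Tactic.RingSolver using (solve; solve-∀)
open import Data.List using (List; []; _∷_; map; upTo; length; filter; [_]; _++_)
open import Data.List.Membership.Propositional using (_∈_)
open import Data.List.Membership.Propositional.Properties using (∈-++⁺ˡ; ∈-++⁺ʳ; ∈-++⁻; ∈-map⁺; ∈-map⁻; ∈-upTo⁺; ∈-upTo⁻; ∈-deduplicate⁺)
open import Data.List.Properties using (upTo-∷ʳ; map-++; filter-++; length-++; filter-accept; filter-reject)
open import Data.List.Relation.Binary.Permutation.Propositional using (_↭_; ↭-refl; ↭-trans; ↭-sym; prep; swap)
open import Data.List.Relation.Binary.Permutation.Propositional.Properties using (∈-resp-↭; All-resp-↭)
open import Data.List.Relation.Unary.All as All using (All)
open import Data.List.Relation.Unary.AllPairs using (AllPairs)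
open import Data.List.Relation.Unary.Any using (here; there)
open import Data.Nat as ℕ using (ℕ; zero; suc; s≤s; z≤n)
open import Data.Nat.Coprimality using (Coprime; coprime-divisor; Bézout-coprime)
open import Data.Nat.Divisibility using (_∣_; divides)
open import Data.Nat.GCD using (gcd; gcd-GCD; gcd[m,n]≢0; gcd[m,n]∣m; gcd[m,n]∣n; module Bézout)
import Data.Nat.Properties as ℕₚ
import Data.Nat.Tactic.RingSolver as ℕ-Ring
open import Data.Product using (∃; ∃₂; _×_; _,_; proj₁; proj₂; map₂)
open import Data.Product.Properties using (≡-dec)
open import Data.Sign using (Sign)
open import Data.Sum using (_⊎_; inj₁; inj₂; [_,_]′)
open import Function using (_∘_)
open import Relation.Binary.Definitions using (Tri; tri<; tri≈; tri>)
open import Relation.Binary.PropositionalEquality using (_≡_; _≢_; refl; sym; trans; cong; cong₂; subst; subst₂; module ≡-Reasoning)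
open import Relation.Nullary using (¬_; contradiction; yes; no)
open import Relation.Nullary.Decidable using (T?)
open import Relation.Unary using (Decidable)

-- Signs of integer expressions

-- No real number is available: α exists only through a Boolean test for the sign of x + y√D. That
-- this test yields a total, translation-invariant, Archimedean order on the pairs (j , m) has to be
-- derived from integer inequalities between x² and Dy². In return, equality of lengths is equality
-- of pairs, so an equation between two gaps is also an equation between differences of indices.
-- This is what turns a statement about lengths into n = p + q.

0<-resp : ∀ {x y} → + 0 < x → x ≡ y → + 0 < y
0<-resp p refl = p

0<-+ : ∀ {x y} → + 0 < x → + 0 < y → + 0 < x + y
0<-+ = +-mono-<

0<-+-0≤ : ∀ {x y} → + 0 < x → + 0 ≤ y → + 0 < x + y
0<-+-0≤ = +-mono-<-≤

0<-* : ∀ {x y} → + 0 < x → + 0 < y → + 0 < x * y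
0<-* {+[1+ m ]} {+[1+ n ]} _ _ = +<+ (s≤s z≤n)
0<-* {+ zero} (+<+ ()) _
0<-* {+[1+ m ]} {+ zero} _ (+<+ ())

0≤-* : ∀ {x y} → + 0 ≤ x → + 0 ≤ y → + 0 ≤ x * y
0≤-* {+ m} {+ n} _ _ = subst (+ 0 ≤_) (pos-* m n) (+≤+ z≤n)

0≤x² : ∀ x → + 0 ≤ x * x
0≤x² (+ n)    = 0≤-* {+ n} {+ n} (+≤+ z≤n) (+≤+ z≤n)
0≤x² -[1+ n ] = +≤+ z≤n

0<x² : ∀ x → x ≢ + 0 → + 0 < x * x
0<x² (+ zero) x≢0 = ⊥-elim (x≢0 refl)
0<x² +[1+ n ] _   = +<+ (s≤s z≤n)
0<x² -[1+ n ] _   = +<+ (s≤s z≤n)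

0<-*-cancelˡ : ∀ {x y} → + 0 < x → + 0 < x * y → + 0 < y
0<-*-cancelˡ {+[1+ m ]} {+ zero} _ p = ⊥-elim (<-irrefl refl (0<-resp p (*-zeroʳ +[1+ m ])))
0<-*-cancelˡ {+[1+ m ]} {+[1+ n ]} _ _ = +<+ (s≤s z≤n)
0<-*-cancelˡ {+[1+ m ]} { -[1+ n ]} _ ()
0<-*-cancelˡ {+ zero} (+<+ ())

≤0⊎0< : ∀ x → + 0 ≤ - x ⊎ + 0 < x
≤0⊎0< (+ zero) = inj₁ (+≤+ z≤n)
≤0⊎0< +[1+ n ] = inj₂ (+<+ (s≤s z≤n))
≤0⊎0< -[1+ n ] = inj₁ (+≤+ z≤n)

0≤∧0<-⇒⊥ : ∀ {x} → + 0 ≤ x → ¬ (+ 0 < - x)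
0≤∧0<-⇒⊥ {+ zero} _ (+<+ ())
0≤∧0<-⇒⊥ {+[1+ n ]} _ ()

<⇒0<- : ∀ {x y} → x < y → + 0 < y - x
<⇒0<- {x} {y} p = subst (_< y - x) (+-inverseʳ x) (+-monoˡ-< (- x) p)

0<-⇒< : ∀ {x y} → + 0 < y - x → x < y
0<-⇒< {x} {y} p = subst₂ _<_ (+-identityˡ x) ([y-x]+x≡y x y) (+-monoˡ-< x p)
  where
  [y-x]+x≡y : ∀ x y → y - x + x ≡ y
  [y-x]+x≡y = solve-∀

0<⇒0≤-1 : ∀ {x} → + 0 < x → + 0 ≤ x - + 1
0<⇒0≤-1 {+[1+ n ]} _ = +≤+ z≤n
0<⇒0≤-1 {+ zero} (+<+ ())

-- No integer lies strictly between -1 and 0, the only range where this polynomial is negative. It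
-- controls a linear term of unknown sign in `archimedean`.
0≤x²+x : ∀ x → + 0 ≤ x * x + x
0≤x²+x (+ n)    = +-mono-≤ (0≤x² (+ n)) (+≤+ z≤n)
0≤x²+x -[1+ n ] = subst (+ 0 ≤_) (shift (+ n)) (0≤-* {+ 1 + + n} {+ n} (+≤+ z≤n) (+≤+ z≤n))
  where
  shift : ∀ k → (+ 1 + k) * k ≡ (- (+ 1 + k)) * (- (+ 1 + k)) + (- (+ 1 + k))
  shift = solve-∀

<?ᵇ⇒< : ∀ x y → (x <?ᵇ y) ≡ true → x < y
<?ᵇ⇒< x y eq = ≰⇒> λ y≤x → case-true (y ≤ᵇ x) eq (≤⇒≤ᵇ y≤x)
  where
  case-true : ∀ b → not b ≡ true → ¬ T b
  case-true false _ ()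

<⇒<?ᵇ : ∀ x y → x < y → (x <?ᵇ y) ≡ true
<⇒<?ᵇ x y x<y with y ≤ᵇ x in eq
... | false = refl
... | true  = contradiction (≤ᵇ⇒≤ (subst T (sym eq) _)) (<⇒≱ x<y)

-- A positive factor x + y cancels from x² - y²; otherwise x - y = 2x - (x + y) is positive anyway.
-- The sign of y stays free, as the mixed products below require.
square-cancel-< : ∀ x y → + 0 < x → + 0 < x * x - y * y → + 0 < x - y
square-cancel-< x y 0<x p = by-sign (≤0⊎0< (x + y))
  where
  by-sign : + 0 ≤ - (x + y) ⊎ + 0 < x + y → + 0 < x - y
  by-sign (inj₁ q) = 0<-resp (0<-+-0≤ (0<-+ 0<x 0<x) q) (solve (x ∷ y ∷ []))
  by-sign (inj₂ q) = 0<-*-cancelˡ {x + y} {x - y} q (0<-resp p (solve (x ∷ y ∷ [])))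

*-mono-gap : ∀ a b c d → + 0 ≤ a → + 0 < b - a → + 0 ≤ c → + 0 < d - c → + 0 < b * d - a * c
*-mono-gap a b c d 0≤a a<b 0≤c c<d =
  0<-resp (0<-+-0≤ (0<-* a<b 0<d) (0≤-* 0≤a (<⇒≤ c<d))) (solve (a ∷ b ∷ c ∷ d ∷ []))
  where
  0<d : + 0 < d
  0<d = 0<-resp (0<-+-0≤ c<d 0≤c) (solve (c ∷ d ∷ []))

-- In lowest terms x/y = u/v the equation becomes u² = dv². Then v divides u², hence u by
-- coprimality, so v = 1.
square-ratio-ℕ : ∀ x y d → y ≢ 0 → x ℕ.* x ≡ d ℕ.* (y ℕ.* y) → ∃ λ t → t ℕ.* t ≡ d
square-ratio-ℕ x y d y≢0 eq with gcd[m,n]∣m x y | gcd[m,n]∣n x y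
... | divides u x≡ug | divides v y≡vg = u , u²≡d
  where
  g = gcd x y
  instance
    g≢0 : ℕ.NonZero g
    g≢0 = ℕ.≢-nonZero (gcd[m,n]≢0 x y (inj₂ y≢0))
  coprime : Coprime v u
  coprime (d∣v , d∣u) = Bézout-coprime {d = g} {m = u} {n = v}
    (subst₂ (Bézout.Identity g) x≡ug y≡vg (Bézout.identity (gcd-GCD x y))) (d∣u , d∣v)
  u²≡dv² : u ℕ.* u ≡ d ℕ.* (v ℕ.* v)
  u²≡dv² = ℕₚ.*-cancelʳ-≡ _ _ (g ℕ.* g) {{ℕₚ.m*n≢0 g g}} (begin
    u ℕ.* u ℕ.* (g ℕ.* g)             ≡⟨ square-* u g ⟩
    u ℕ.* g ℕ.* (u ℕ.* g)             ≡⟨ cong₂ ℕ._*_ (sym x≡ug) (sym x≡ug) ⟩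
    x ℕ.* x                           ≡⟨ eq ⟩
    d ℕ.* (y ℕ.* y)                   ≡⟨ cong (λ z → d ℕ.* (z ℕ.* z)) y≡vg ⟩
    d ℕ.* (v ℕ.* g ℕ.* (v ℕ.* g))     ≡⟨ scaled-square-* d v g ⟩
    d ℕ.* (v ℕ.* v) ℕ.* (g ℕ.* g)     ∎)
    where
    open ≡-Reasoning
    square-* : ∀ u g → u ℕ.* u ℕ.* (g ℕ.* g) ≡ u ℕ.* g ℕ.* (u ℕ.* g)
    square-* = ℕ-Ring.solve-∀
    scaled-square-* : ∀ d v g → d ℕ.* (v ℕ.* g ℕ.* (v ℕ.* g)) ≡ d ℕ.* (v ℕ.* v) ℕ.* (g ℕ.* g)
    scaled-square-* = ℕ-Ring.solve-∀
  v∣u : v ∣ u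
  v∣u = coprime-divisor coprime (divides (d ℕ.* v) (trans u²≡dv² (sym (ℕₚ.*-assoc d v v))))
  v≡1 : v ≡ 1
  v≡1 = coprime (divides 1 (sym (ℕₚ.*-identityˡ v)) , v∣u)
  u²≡d : u ℕ.* u ≡ d
  u²≡d = trans u²≡dv² (trans (cong (λ z → d ℕ.* (z ℕ.* z)) v≡1) (ℕₚ.*-identityʳ d))

square-ratio : ∀ x y D → + 0 ≤ D → y ≢ + 0 → x * x ≡ D * (y * y) → ∃ λ t → t * t ≡ D
square-ratio x y (+ d) _ y≢0 eq
  with square-ratio-ℕ ∣ x ∣ ∣ y ∣ d (y≢0 ∘ ∣i∣≡0⇒i≡0)
         (trans (sym (abs-* x x)) (trans (cong ∣_∣ eq)
           (trans (abs-* (+ d) (y * y)) (cong (d ℕ.*_) (abs-* y y)))))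
... | t , refl = + t , sym (pos-* t t)

-- The ordered group ℤ + ℤ√D

module Surd (D : ℤ) (D>0 : + 0 < D) (D-nonsq : ∀ t → t * t ≢ D) where

  -- For a nonzero x + y√D, the sign is the sign of x if the norm x² − Dy²
  -- is positive and the sign of y if it is negative.
  data Positive : ℤ → ℤ → Set where
    norm>0 : ∀ {x y} → + 0 < x → + 0 < x * x - D * (y * y) → Positive x y
    norm<0 : ∀ {x y} → + 0 < y → + 0 < D * (y * y) - x * x → Positive x y

  0≤Dy² : ∀ y → + 0 ≤ D * (y * y)
  0≤Dy² y = 0≤-* (<⇒≤ D>0) (0≤x² y)

  norm≡0⇒≡0 : ∀ x y → x * x ≡ D * (y * y) → x ≡ + 0 × y ≡ + 0
  norm≡0⇒≡0 x y eq with y ≟ + 0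
  ... | no y≢0 with square-ratio x y D (<⇒≤ D>0) y≢0 eq
  ...   | t , t²≡D = contradiction t²≡D (D-nonsq t)
  norm≡0⇒≡0 x y eq | yes refl with i*j≡0⇒i≡0∨j≡0 x (trans eq (*-zeroʳ D))
  ...   | inj₁ x≡0 = x≡0 , refl
  ...   | inj₂ x≡0 = x≡0 , refl

  tri : ∀ x y → (x ≡ + 0 × y ≡ + 0) ⊎ Positive x y ⊎ Positive (- x) (- y)
  tri x y = by-norm (<-cmp (x * x) (D * (y * y)))
    where
    Trichotomy = (x ≡ + 0 × y ≡ + 0) ⊎ Positive x y ⊎ Positive (- x) (- y)

    by-y : + 0 < D * (y * y) - x * x → Tri (+ 0 < y) (+ 0 ≡ y) (y < + 0) → Trichotomy
    by-y n (tri< 0<y _ _)  = inj₂ (inj₁ (norm<0 0<y n))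
    by-y n (tri> _ _ y<0)  = inj₂ (inj₂ (norm<0 (neg-mono-< y<0) (0<-resp n (solve (x ∷ y ∷ D ∷ [])))))
    by-y n (tri≈ _ refl _) = ⊥-elim (0≤∧0<-⇒⊥ (0≤x² x) (0<-resp n (solve (x ∷ D ∷ []))))

    by-x : + 0 < x * x - D * (y * y) → Tri (+ 0 < x) (+ 0 ≡ x) (x < + 0) → Trichotomy
    by-x n (tri< 0<x _ _)  = inj₂ (inj₁ (norm>0 0<x n))
    by-x n (tri> _ _ x<0)  = inj₂ (inj₂ (norm>0 (neg-mono-< x<0) (0<-resp n (solve (x ∷ y ∷ D ∷ [])))))
    by-x n (tri≈ _ refl _) = ⊥-elim (0≤∧0<-⇒⊥ (0≤Dy² y) (0<-resp n (solve (y ∷ D ∷ []))))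

    by-norm : Tri (x * x < D * (y * y)) (x * x ≡ D * (y * y)) (D * (y * y) < x * x) → Trichotomy
    by-norm (tri< lt _ _) = by-y (<⇒0<- lt) (<-cmp (+ 0) y)
    by-norm (tri≈ _ eq _) = inj₁ (norm≡0⇒≡0 x y eq)
    by-norm (tri> _ _ gt) = by-x (<⇒0<- gt) (<-cmp (+ 0) x)

  ¬[0<∧0<-] : ∀ {x} → + 0 < x → ¬ (+ 0 < - x)
  ¬[0<∧0<-] = 0≤∧0<-⇒⊥ ∘ <⇒≤

  asym : ∀ {x y} → Positive x y → ¬ Positive (- x) (- y)
  asym {x} {y} (norm>0 p n) (norm>0 p′ n′) = ¬[0<∧0<-] p p′
  asym {x} {y} (norm>0 p n) (norm<0 p′ n′) = ¬[0<∧0<-] n (0<-resp n′ (solve (x ∷ y ∷ D ∷ [])))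
  asym {x} {y} (norm<0 p n) (norm>0 p′ n′) = ¬[0<∧0<-] n (0<-resp n′ (solve (x ∷ y ∷ D ∷ [])))
  asym {x} {y} (norm<0 p n) (norm<0 p′ n′) = ¬[0<∧0<-] p p′

  -- Multiplying Dy² < x² by x′² < Dy′² and cancelling D gives (x′y)² < (xy′)². So the determinant
  -- of a positive element of positive norm and one of negative norm has a fixed sign.
  cross : ∀ x y x′ y′ → + 0 < x → + 0 < x * x - D * (y * y) →
          + 0 < y′ → + 0 < D * (y′ * y′) - x′ * x′ → + 0 < x * y′ - x′ * y
  cross x y x′ y′ 0<x n 0<y′ n′ = square-cancel-< (x * y′) (x′ * y) (0<-* 0<x 0<y′)
    (0<-*-cancelˡ {D} {x * y′ * (x * y′) - x′ * y * (x′ * y)} D>0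
      (0<-resp (*-mono-gap (D * (y * y)) (x * x) (x′ * x′) (D * (y′ * y′)) (0≤Dy² y) n (0≤x² x′) n′)
        (solve (x ∷ y ∷ x′ ∷ y′ ∷ D ∷ []))))

  -- The norm of the sum can have either sign, so the other outcomes of `tri` are excluded instead.
  -- A vanishing sum makes the determinant of `cross` zero. If the negated sum were positive,
  -- `cross` applied to it and the summand of opposite norm sign would reverse that determinant.
  mixed-sum : ∀ x y x′ y′ → + 0 < x → + 0 < x * x - D * (y * y) →
              + 0 < y′ → + 0 < D * (y′ * y′) - x′ * x′ → Positive (x + x′) (y + y′)
  mixed-sum x y x′ y′ 0<x n 0<y′ n′ = positive (tri (x + x′) (y + y′))
    where
    open ≡-Reasoning
    0<xy′-x′y = cross x y x′ y′ 0<x n 0<y′ n′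

    positive : (x + x′ ≡ + 0 × y + y′ ≡ + 0) ⊎ Positive (x + x′) (y + y′) ⊎
               Positive (- (x + x′)) (- (y + y′)) → Positive (x + x′) (y + y′)
    positive (inj₂ (inj₁ P)) = P
    positive (inj₁ (X≡0 , Y≡0)) = ⊥-elim (<-irrefl refl (0<-resp 0<xy′-x′y (begin
      x * y′ - x′ * y              ≡⟨ solve (x ∷ y ∷ x′ ∷ y′ ∷ []) ⟩
      x * (y + y′) - (x + x′) * y  ≡⟨ cong₂ (λ X Y → x * Y - X * y) X≡0 Y≡0 ⟩
      x * + 0 - + 0 * y            ≡⟨ solve (x ∷ y ∷ []) ⟩
      + 0                          ∎)))
    positive (inj₂ (inj₂ (norm>0 p N))) = ⊥-elim (¬[0<∧0<-] 0<xy′-x′y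
      (0<-resp (cross (- (x + x′)) (- (y + y′)) x′ y′ p N 0<y′ n′) (solve (x ∷ y ∷ x′ ∷ y′ ∷ []))))
    positive (inj₂ (inj₂ (norm<0 p N))) = ⊥-elim (¬[0<∧0<-] 0<xy′-x′y
      (0<-resp (cross x y (- (x + x′)) (- (y + y′)) 0<x n p N) (solve (x ∷ y ∷ x′ ∷ y′ ∷ []))))

  -- For norms of equal sign, the norm of the sum is the two norms plus twice the mixed term `c`,
  -- whose sign follows by comparing squares.
  sum : ∀ {x y x′ y′} → Positive x y → Positive x′ y′ → Positive (x + x′) (y + y′)
  sum {x} {y} {x′} {y′} (norm>0 p n) (norm>0 p′ n′) = norm>0 (0<-+ p p′)
    (0<-resp (0<-+ (0<-+ n n′) (0<-+ c c)) (solve (x ∷ y ∷ x′ ∷ y′ ∷ D ∷ [])))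
    where
    c : + 0 < x * x′ - D * (y * y′)
    c = square-cancel-< (x * x′) (D * (y * y′)) (0<-* p p′)
      (0<-resp (*-mono-gap (D * (y * y)) (x * x) (D * (y′ * y′)) (x′ * x′) (0≤Dy² y) n (0≤Dy² y′) n′)
        (solve (x ∷ y ∷ x′ ∷ y′ ∷ D ∷ [])))
  sum {x} {y} {x′} {y′} (norm<0 p n) (norm<0 p′ n′) = norm<0 (0<-+ p p′)
    (0<-resp (0<-+ (0<-+ n n′) (0<-+ c c)) (solve (x ∷ y ∷ x′ ∷ y′ ∷ D ∷ [])))
    where
    c : + 0 < D * (y * y′) - x * x′
    c = square-cancel-< (D * (y * y′)) (x * x′) (0<-* D>0 (0<-* p p′))
      (0<-resp (*-mono-gap (x * x) (D * (y * y)) (x′ * x′) (D * (y′ * y′)) (0≤x² x) n (0≤x² x′) n′)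
        (solve (x ∷ y ∷ x′ ∷ y′ ∷ D ∷ [])))
  sum {x} {y} {x′} {y′} (norm>0 p n) (norm<0 p′ n′) = mixed-sum x y x′ y′ p n p′ n′
  sum {x} {y} {x′} {y′} (norm<0 p n) (norm>0 p′ n′) =
    subst₂ Positive (+-comm x′ x) (+-comm y′ y) (mixed-sum x′ y′ x y p′ n′ p n)

  archimedean : ∀ {x y} c → + 0 < c → Positive x y → ∃ λ t → Positive (+ t * x - c) (+ t * y)
  archimedean {x} {y} c 0<c (norm>0 p n) =
    ∣ τ ∣ , subst (λ t → Positive (t * x - c) (t * y)) (sym (0≤i⇒+∣i∣≡i (<⇒≤ 0<τ)))
      (norm>0
        (0<-resp (0<-+-0≤ (0<-+ p (0<-* 0<c (0<-* p p))) (0≤-* (<⇒≤ 0<c) (0<⇒0≤-1 (0<-* p p)))) (id₁ x c))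
        (0<-resp (0<-+-0≤ (0<-+-0≤ 0<τ (0≤-* (0≤x² τ) (0<⇒0≤-1 n))) (0≤x² c)) (id₂ x y c D)))
    where
    -- The norm N = x² - Dy² is an integer, so N ≥ 1. With τ = 1 + 2xc the new norm τ²N - 2τxc + c²
    -- is at least τ(τ - 2xc) + c² = τ + c².
    τ = + 1 + (x * c + x * c)

    0<τ : + 0 < τ
    0<τ = 0<-+ (+<+ (s≤s z≤n)) (0<-+ (0<-* p 0<c) (0<-* p 0<c))

    id₁ : ∀ x c → x + c * (x * x) + c * (x * x - + 1) ≡ (+ 1 + (x * c + x * c)) * x - c
    id₁ = solve-∀

    id₂ : ∀ x y c D → let τ = + 1 + (x * c + x * c) in
          τ + τ * τ * (x * x - D * (y * y) - + 1) + c * c ≡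
          (τ * x - c) * (τ * x - c) - D * (τ * y * (τ * y))
    id₂ = solve-∀
  archimedean {x} {y} c 0<c (norm<0 p n) =
    ∣ τ ∣ , subst (λ t → Positive (t * x - c) (t * y)) (sym (0≤i⇒+∣i∣≡i (<⇒≤ 0<τ)))
      (norm<0
        (0<-* 0<τ p)
        (0<-resp
          (0<-+-0≤ (0<-+-0≤ (0<-+-0≤ 0<τ (0≤-* (0≤x² τ) (0<⇒0≤-1 n)))
            (0≤-* (<⇒≤ (0<-* (0<-+ 0<c 0<c) 0<τ)) (0≤x²+x x)))
            (0≤-* (0≤x² c) 0≤τ-1))
          (id₂ x y c D)))
    where
    -- Here x may be negative. The summand 2x²c of τ offsets the term 2τxc, since x² + x ≥ 0, and
    -- the summand c² offsets -c².
    τ = + 1 + (x * x * c + x * x * c + c * c)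

    0≤τ-1 : + 0 ≤ x * x * c + x * x * c + c * c
    0≤τ-1 = +-mono-≤ (+-mono-≤ (0≤-* (0≤x² x) (<⇒≤ 0<c)) (0≤-* (0≤x² x) (<⇒≤ 0<c))) (0≤x² c)

    0<τ : + 0 < τ
    0<τ = 0<-+-0≤ (+<+ (s≤s z≤n)) 0≤τ-1

    id₂ : ∀ x y c D → let σ = x * x * c + x * x * c + c * c; τ = + 1 + σ in
          τ + τ * τ * (D * (y * y) - x * x - + 1) + (c + c) * τ * (x * x + x) + c * c * σ ≡
          D * (τ * y * (τ * y)) - (τ * x - c) * (τ * x - c)
    id₂ = solve-∀

  posD⇒Positive : ∀ x y → posD D x y ≡ true → Positive x y
  posD⇒Positive (+ zero)   (+ zero)   ()
  posD⇒Positive (+ zero)   y@(+[1+ n ]) _ = norm<0 (+<+ (s≤s z≤n))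
    (0<-resp (0<-* D>0 (0<-* {y} {y} (+<+ (s≤s z≤n)) (+<+ (s≤s z≤n)))) (sym (+-identityʳ _)))
  posD⇒Positive (+ zero)   -[1+ n ]   ()
  posD⇒Positive x@(+[1+ m ]) (+ zero)   _ = norm>0 (+<+ (s≤s z≤n))
    (0<-resp (0<-* {x} {x} (+<+ (s≤s z≤n)) (+<+ (s≤s z≤n)))
      (sym (trans (cong (λ z → x * x - z) (*-zeroʳ D)) (+-identityʳ (x * x)))))
  -- For two positive parts `posD` does not look at the norm, so `tri` has to find which constructor
  -- applies.
  posD⇒Positive x@(+[1+ m ]) y@(+[1+ n ]) _ with tri x y
  ... | inj₁ (() , _)
  ... | inj₂ (inj₁ P) = P
  ... | inj₂ (inj₂ (norm>0 () _))
  ... | inj₂ (inj₂ (norm<0 () _))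
  posD⇒Positive x@(+[1+ m ]) y@(-[1+ n ]) eq = norm>0 (+<+ (s≤s z≤n))
    (<⇒0<- (subst (_< x * x) (*-comm (y * y) D)
      (<?ᵇ⇒< (y * y * D) (x * x) (trans (sym (∨-identityʳ (y * y * D <?ᵇ x * x))) eq))))
  posD⇒Positive -[1+ m ]   (+ zero)   ()
  posD⇒Positive x@(-[1+ m ]) y@(+[1+ n ]) eq = norm<0 (+<+ (s≤s z≤n))
    (<⇒0<- (subst (x * x <_) (*-comm (y * y) D) (<?ᵇ⇒< (x * x) (y * y * D) eq)))
  posD⇒Positive -[1+ m ]   -[1+ n ]   ()

  Positive⇒posD : ∀ {x y} → Positive x y → posD D x y ≡ true
  Positive⇒posD {+ zero} (norm>0 (+<+ ()) _)
  Positive⇒posD {+[1+ m ]} {+ zero} (norm>0 _ _) = refl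
  Positive⇒posD {+[1+ m ]} {+[1+ n ]} (norm>0 _ _) = refl
  Positive⇒posD {x@(+[1+ m ])} {y@(-[1+ n ])} (norm>0 _ N) =
    trans (∨-identityʳ (y * y * D <?ᵇ x * x))
      (<⇒<?ᵇ (y * y * D) (x * x) (subst (_< x * x) (*-comm D (y * y)) (0<-⇒< N)))
  Positive⇒posD {_} {+ zero} (norm<0 (+<+ ()) _)
  Positive⇒posD {+ zero} {+[1+ n ]} (norm<0 _ _) = refl
  Positive⇒posD {+[1+ m ]} {+[1+ n ]} (norm<0 _ _) = refl
  Positive⇒posD {x@(-[1+ m ])} {y@(+[1+ n ])} (norm<0 _ N) =
    <⇒<?ᵇ (x * x) (y * y * D) (subst (x * x <_) (*-comm D (y * y)) (0<-⇒< N))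

-- Counting in initial segments

count : ∀ {P : ℕ → Set} → Decidable P → ℕ → ℕ
count P? n = length (filter P? (map suc (upTo n)))

module _ {P : ℕ → Set} (P? : Decidable P) where

  count-suc : ∀ n → count P? (suc n) ≡ count P? n ℕ.+ length (filter P? [ suc n ])
  count-suc n = begin
    length (filter P? (map suc (upTo (suc n))))                ≡⟨ cong (length ∘ filter P? ∘ map suc) (sym (upTo-∷ʳ n)) ⟩
    length (filter P? (map suc (upTo n ++ [ n ])))             ≡⟨ cong (length ∘ filter P?) (map-++ suc (upTo n) [ n ]) ⟩
    length (filter P? (map suc (upTo n) ++ [ suc n ]))         ≡⟨ cong length (filter-++ P? (map suc (upTo n)) [ suc n ]) ⟩
    length (filter P? (map suc (upTo n)) ++ filter P? [ suc n ]) ≡⟨ length-++ (filter P? (map suc (upTo n))) ⟩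
    count P? n ℕ.+ length (filter P? [ suc n ])                ∎
    where open ≡-Reasoning

  count-yes : ∀ n → P (suc n) → count P? (suc n) ≡ suc (count P? n)
  count-yes n p = trans (count-suc n)
    (trans (cong (λ xs → count P? n ℕ.+ length xs) (filter-accept P? p)) (ℕₚ.+-comm (count P? n) 1))

  count-no : ∀ n → ¬ P (suc n) → count P? (suc n) ≡ count P? n
  count-no n ¬p = trans (count-suc n)
    (trans (cong (λ xs → count P? n ℕ.+ length xs) (filter-reject P? ¬p)) (ℕₚ.+-identityʳ (count P? n)))

  count≤n : ∀ n → count P? n ℕ.≤ n
  count≤n zero = z≤n
  count≤n (suc n) with P? (suc n)
  ... | yes p = subst (ℕ._≤ suc n) (sym (count-yes n p)) (s≤s (count≤n n))
  ... | no ¬p = subst (ℕ._≤ suc n) (sym (count-no n ¬p)) (ℕₚ.m≤n⇒m≤1+n (count≤n n))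

  -- The members among 1, ..., n form an initial segment, so their number is also the last of them.
  -- This makes `floorMul`, defined by counting, a floor. The alternatives c = 0 and c = n are the
  -- ends where the range gives no information.
  count-down-closed : (∀ {m n} → m ℕ.≤ n → P n → P m) → ∀ n →
    let c = count P? n in (c ≡ 0 ⊎ P c) × (c ≡ n ⊎ ¬ P (suc c))
  count-down-closed closed zero = inj₁ refl , inj₁ refl
  count-down-closed closed (suc n) with P? (suc n) | count-down-closed closed n
  ... | yes p | _ , inj₁ c≡n rewrite count-yes n p | c≡n = inj₂ p , inj₁ refl
  ... | yes p | _ , inj₂ ¬Pc = contradiction (closed (s≤s (count≤n n)) p) ¬Pc
  ... | no ¬p | lo , inj₁ c≡n rewrite count-no n ¬p = lo , inj₂ (subst (¬_ ∘ P ∘ suc) (sym c≡n) ¬p)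
  ... | no ¬p | lo , inj₂ ¬Pc rewrite count-no n ¬p = lo , inj₂ ¬Pc

  -- Each member is charged K units of the distance from its predecessor. Only N₁ + 1 members may go
  -- uncharged: those counted while the count is at most N₁, and the next one.
  count-sparse : ∀ K N₁ →
    (∀ {m n} → N₁ ℕ.≤ m → m ℕ.< n → P m → P n → m ℕ.+ K ℕ.≤ n) →
    ∀ n → K ℕ.* count P? n ℕ.≤ n ℕ.+ K ℕ.* suc N₁
  count-sparse K N₁ sparse n = [ few , many ]′ (invariant n)
    where
    -- The bound is kept at the last member `l`, not at `n`, because the spacing hypothesis measures
    -- from `l` to the next member.
    Invariant : ℕ → Set
    Invariant n = count P? n ℕ.≤ N₁ ⊎
      ∃ λ l → N₁ ℕ.≤ l × l ℕ.≤ n × P l × K ℕ.* count P? n ℕ.≤ l ℕ.+ K ℕ.* suc N₁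

    few : ∀ {n} → count P? n ℕ.≤ N₁ → K ℕ.* count P? n ℕ.≤ n ℕ.+ K ℕ.* suc N₁
    few {n} c≤N₁ = ℕₚ.≤-trans (ℕₚ.*-monoʳ-≤ K (ℕₚ.m≤n⇒m≤1+n c≤N₁)) (ℕₚ.m≤n+m _ n)

    many : ∀ {n} → (∃ λ l → N₁ ℕ.≤ l × l ℕ.≤ n × P l × K ℕ.* count P? n ℕ.≤ l ℕ.+ K ℕ.* suc N₁) →
           K ℕ.* count P? n ℕ.≤ n ℕ.+ K ℕ.* suc N₁
    many (l , _ , l≤n , _ , le) = ℕₚ.≤-trans le (ℕₚ.+-monoˡ-≤ _ l≤n)

    new : ∀ n → N₁ ℕ.≤ suc n → P (suc n) → Invariant n →
          K ℕ.* suc (count P? n) ℕ.≤ suc n ℕ.+ K ℕ.* suc N₁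
    new n _ _ (inj₁ c≤N₁) = ℕₚ.≤-trans (ℕₚ.*-monoʳ-≤ K (s≤s c≤N₁)) (ℕₚ.m≤n+m _ (suc n))
    new n N₁≤ p (inj₂ (l , N₁≤l , l≤n , Pl , le)) = begin
      K ℕ.* suc (count P? n)           ≡⟨ ℕₚ.*-suc K (count P? n) ⟩
      K ℕ.+ K ℕ.* count P? n           ≤⟨ ℕₚ.+-monoʳ-≤ K le ⟩
      K ℕ.+ (l ℕ.+ K ℕ.* suc N₁)       ≡⟨ sym (ℕₚ.+-assoc K l _) ⟩
      K ℕ.+ l ℕ.+ K ℕ.* suc N₁         ≤⟨ ℕₚ.+-monoˡ-≤ _ (subst (ℕ._≤ suc n) (ℕₚ.+-comm l K) (sparse N₁≤l (s≤s l≤n) Pl p)) ⟩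
      suc n ℕ.+ K ℕ.* suc N₁           ∎
      where open ℕₚ.≤-Reasoning

    invariant : ∀ n → Invariant n
    invariant zero = inj₁ z≤n
    invariant (suc n) with P? (suc n)
    invariant (suc n) | yes p with N₁ ℕₚ.≤? suc n
    ... | yes N₁≤ = inj₂ (suc n , N₁≤ , ℕₚ.≤-refl , p ,
            subst (λ c → K ℕ.* c ℕ.≤ suc n ℕ.+ K ℕ.* suc N₁) (sym (count-yes n p)) (new n N₁≤ p (invariant n)))
    ... | no N₁≰ = inj₁ (ℕₚ.≤-trans (count≤n (suc n)) (ℕₚ.<⇒≤ (ℕₚ.≰⇒> N₁≰)))
    invariant (suc n) | no ¬p with invariant n
    ... | inj₁ c≤N₁ = inj₁ (subst (ℕ._≤ N₁) (sym (count-no n ¬p)) c≤N₁)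
    ... | inj₂ (l , N₁≤l , l≤n , Pl , le) = inj₂ (l , N₁≤l , ℕₚ.m≤n⇒m≤1+n l≤n , Pl ,
            subst (λ c → K ℕ.* c ℕ.≤ l ℕ.+ K ℕ.* suc N₁) (sym (count-no n ¬p)) le)

two-elements : ∀ {A : Set} {xs : List A} {u v} → length xs ≡ 2 → u ∈ xs → v ∈ xs → u ≢ v →
               ∀ {w} → w ∈ xs → w ≡ u ⊎ w ≡ v
two-elements {xs = _ ∷ _ ∷ []} _ (here refl)         (here refl)         u≢v _ = ⊥-elim (u≢v refl)
two-elements {xs = _ ∷ _ ∷ []} _ (there (here refl)) (there (here refl)) u≢v _ = ⊥-elim (u≢v refl)
two-elements {xs = _ ∷ _ ∷ []} _ (here refl)         (there (here refl)) _ (here refl)         = inj₁ refl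
two-elements {xs = _ ∷ _ ∷ []} _ (here refl)         (there (here refl)) _ (there (here refl)) = inj₂ refl
two-elements {xs = _ ∷ _ ∷ []} _ (there (here refl)) (here refl)         _ (here refl)         = inj₂ refl
two-elements {xs = _ ∷ _ ∷ []} _ (there (here refl)) (here refl)         _ (there (here refl)) = inj₁ refl

-- The ordered group ℤ + ℤα

𝟘 𝟙 : Lin
𝟘 = + 0 , + 0
𝟙 = + 0 , + 1

infixl 6 _⊖_
_⊖_ : Lin → Lin → Lin
(j , m) ⊖ (j′ , m′) = j - j′ , m - m′

telescope : ∀ x y z → (y - x) + (z - y) ≡ z - x
telescope = solve-∀

module Order (α : QuadIrr) (irr : IsQuadIrrIn01 α) where
  open QuadIrr α
  open IsQuadIrrIn01 irr
  open Surd D D>0 D-nonsq hiding (asym; sum) renaming (tri to surd-tri)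

  -- 2a²(jα + m) = ratPart (j , m) + irrPart (j , m) √D
  ratPart irrPart : Lin → ℤ
  ratPart (j , m) = a * (+ 2 * a * m - j * b)
  irrPart (j , m) = a * (signℤ ε * j)

  infix 4 _≺_ _≼_
  record _≺_ (u v : Lin) : Set where
    constructor <ᴸ⇒≺
    field ≺⇒<ᴸ : (u <ᴸ v) ≡ true
  open _≺_ public

  _≼_ : Lin → Lin → Set
  u ≼ v = ¬ (v ≺ u)

  positive⇒≺ : ∀ {u v} → Positive (ratPart (v ⊖ u)) (irrPart (v ⊖ u)) → u ≺ v
  positive⇒≺ P = <ᴸ⇒≺ (Positive⇒posD P)

  ≺⇒positive : ∀ {u v} → u ≺ v → Positive (ratPart (v ⊖ u)) (irrPart (v ⊖ u))
  ≺⇒positive {u} {v} (<ᴸ⇒≺ eq) = posD⇒Positive (ratPart (v ⊖ u)) (irrPart (v ⊖ u)) eq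

  -- The order depends only on the difference of the two sides. Most inequalities below are
  -- translates of known ones and reduce to two ring identities.
  ≺-resp : ∀ {j m j′ m′ l n l′ n′} → (j , m) ≺ (j′ , m′) →
           j′ - j ≡ l′ - l → m′ - m ≡ n′ - n → (l , n) ≺ (l′ , n′)
  ≺-resp u≺v j≡l m≡n =
    positive⇒≺ (subst₂ (λ s t → Positive (ratPart (s , t)) (irrPart (s , t))) j≡l m≡n (≺⇒positive u≺v))

  ≺-sum : ∀ {j m j′ m′ k o k′ o′ l n l′ n′} → (j , m) ≺ (j′ , m′) → (k , o) ≺ (k′ , o′) →
          (j′ - j) + (k′ - k) ≡ l′ - l → (m′ - m) + (o′ - o) ≡ n′ - n → (l , n) ≺ (l′ , n′)
  ≺-sum {j} {m} {j′} {m′} {k} {o} {k′} {o′} u≺v w≺z eq₁ eq₂ =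
    positive⇒≺ (subst₂ (λ s t → Positive (ratPart (s , t)) (irrPart (s , t))) eq₁ eq₂
      (subst₂ Positive (rat-+ a b (j′ - j) (m′ - m) (k′ - k) (o′ - o)) (irr-+ a (signℤ ε) (j′ - j) (k′ - k))
        (Surd.sum D D>0 D-nonsq (≺⇒positive u≺v) (≺⇒positive w≺z))))
    where
    rat-+ : ∀ a b j m j′ m′ → a * (+ 2 * a * m - j * b) + a * (+ 2 * a * m′ - j′ * b) ≡
            a * (+ 2 * a * (m + m′) - (j + j′) * b)
    rat-+ = solve-∀
    irr-+ : ∀ a e j j′ → a * (e * j) + a * (e * j′) ≡ a * (e * (j + j′))
    irr-+ = solve-∀

  ≺-trans : ∀ {u v w} → u ≺ v → v ≺ w → u ≺ w
  ≺-trans {j , m} {j′ , m′} {j″ , m″} u≺v v≺w = ≺-sum u≺v v≺w (telescope j j′ j″) (telescope m m′ m″)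

  rat-neg : ∀ a b j m j′ m′ → a * (+ 2 * a * (m - m′) - (j - j′) * b) ≡
            - (a * (+ 2 * a * (m′ - m) - (j′ - j) * b))
  rat-neg = solve-∀
  irr-neg : ∀ a e j j′ → a * (e * (j - j′)) ≡ - (a * (e * (j′ - j)))
  irr-neg = solve-∀

  ≺-asym : ∀ {u v} → u ≺ v → ¬ (v ≺ u)
  ≺-asym {j , m} {j′ , m′} u≺v v≺u = Surd.asym D D>0 D-nonsq (≺⇒positive u≺v)
    (subst₂ Positive (rat-neg a b j m j′ m′) (irr-neg a (signℤ ε) j j′) (≺⇒positive v≺u))

  ≺-irrefl : ∀ {u} → ¬ (u ≺ u)
  ≺-irrefl u≺u = ≺-asym u≺u u≺u

  a*x≡0⇒x≡0 : ∀ {x} → a * x ≡ + 0 → x ≡ + 0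
  a*x≡0⇒x≡0 eq with i*j≡0⇒i≡0∨j≡0 a eq
  ... | inj₁ a≡0 = ⊥-elim (a≢0 a≡0)
  ... | inj₂ x≡0 = x≡0

  parts≡0⇒≡𝟘 : ∀ j m → ratPart (j , m) ≡ + 0 → irrPart (j , m) ≡ + 0 → j ≡ + 0 × m ≡ + 0
  parts≡0⇒≡𝟘 j m rat≡0 irr≡0 = j≡0 , m≡0
    where
    sign-cancel : ∀ s x → signℤ s * x ≡ + 0 → x ≡ + 0
    sign-cancel Sign.+ x eq = trans (sym (*-identityˡ x)) eq
    sign-cancel Sign.- x eq = neg-injective (trans (sym (-1*i≡-i x)) eq)
    j≡0 : j ≡ + 0
    j≡0 = sign-cancel ε j (a*x≡0⇒x≡0 irr≡0)
    expand : ∀ a b m → a * (+ 2 * m) ≡ + 2 * a * m - + 0 * b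
    expand = solve-∀
    m≡0 : m ≡ + 0
    m≡0 with i*j≡0⇒i≡0∨j≡0 (+ 2) (a*x≡0⇒x≡0 (trans (expand a b m)
               (trans (cong (λ i → + 2 * a * m - i * b) (sym j≡0)) (a*x≡0⇒x≡0 rat≡0))))
    ... | inj₂ m≡0 = m≡0

  ≺-cmp : ∀ u v → u ≡ v ⊎ u ≺ v ⊎ v ≺ u
  ≺-cmp u@(j , m) v@(j′ , m′) = by-sign (surd-tri (ratPart (v ⊖ u)) (irrPart (v ⊖ u)))
    where
    by-sign : _ → u ≡ v ⊎ u ≺ v ⊎ v ≺ u
    by-sign (inj₁ (r≡0 , i≡0)) with parts≡0⇒≡𝟘 (j′ - j) (m′ - m) r≡0 i≡0
    ... | j≡ , m≡ = inj₁ (cong₂ _,_ (sym (i-j≡0⇒i≡j j′ j j≡)) (sym (i-j≡0⇒i≡j m′ m m≡)))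
    by-sign (inj₂ (inj₁ P)) = inj₂ (inj₁ (positive⇒≺ P))
    by-sign (inj₂ (inj₂ P)) = inj₂ (inj₂ (positive⇒≺
      (subst₂ Positive (sym (rat-neg a b j m j′ m′)) (sym (irr-neg a (signℤ ε) j j′)) P)))

  ≼-≺-trans : ∀ {u v w} → u ≼ v → v ≺ w → u ≺ w
  ≼-≺-trans {u} {v} u≼v v≺w with ≺-cmp u v
  ... | inj₁ refl       = v≺w
  ... | inj₂ (inj₁ u≺v) = ≺-trans u≺v v≺w
  ... | inj₂ (inj₂ v≺u) = ⊥-elim (u≼v v≺u)

  ≺-≼-trans : ∀ {u v w} → u ≺ v → v ≼ w → u ≺ w
  ≺-≼-trans {v = v} {w} u≺v v≼w with ≺-cmp v w
  ... | inj₁ refl       = u≺v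
  ... | inj₂ (inj₁ v≺w) = ≺-trans u≺v v≺w
  ... | inj₂ (inj₂ w≺v) = ⊥-elim (v≼w w≺v)

  ≼-trans : ∀ {u v w} → u ≼ v → v ≼ w → u ≼ w
  ≼-trans u≼v v≼w w≺u = v≼w (≺-≼-trans w≺u u≼v)

  ≼-antisym : ∀ {u v} → u ≼ v → v ≼ u → u ≡ v
  ≼-antisym {u} {v} u≼v v≼u with ≺-cmp u v
  ... | inj₁ u≡v        = u≡v
  ... | inj₂ (inj₁ u≺v) = ⊥-elim (v≼u u≺v)
  ... | inj₂ (inj₂ v≺u) = ⊥-elim (u≼v v≺u)

  ≼∧≢⇒≺ : ∀ {u v} → u ≼ v → u ≢ v → u ≺ v
  ≼∧≢⇒≺ {u} {v} u≼v u≢v with ≺-cmp u v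
  ... | inj₁ u≡v        = ⊥-elim (u≢v u≡v)
  ... | inj₂ (inj₁ u≺v) = u≺v
  ... | inj₂ (inj₂ v≺u) = ⊥-elim (u≼v v≺u)

  0<2a² : + 0 < + 2 * (a * a)
  0<2a² = 0<-* {+ 2} {a * a} (+<+ (s≤s z≤n)) (0<x² a a≢0)

  <⇒≺ : ∀ j {m n} → m < n → (j , m) ≺ (j , n)
  <⇒≺ j {m} {n} m<n = positive⇒≺ (norm>0
    (0<-resp (0<-* 0<2a² 0<d) (id₁ a b j m n))
    (0<-resp (0<-* (0<-* 0<2a² 0<d) (0<-* 0<2a² 0<d)) (id₂ a b (signℤ ε) D j m n)))
    where
    0<d = <⇒0<- m<n
    id₁ : ∀ a b j m n → + 2 * (a * a) * (n - m) ≡ a * (+ 2 * a * (n - m) - (j - j) * b)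
    id₁ = solve-∀
    id₂ : ∀ a b e D j m n → + 2 * (a * a) * (n - m) * (+ 2 * (a * a) * (n - m)) ≡
          a * (+ 2 * a * (n - m) - (j - j) * b) * (a * (+ 2 * a * (n - m) - (j - j) * b)) -
          D * (a * (e * (j - j)) * (a * (e * (j - j))))
    id₂ = solve-∀

  ≤⇒≼ : ∀ j {m n} → m ≤ n → (j , m) ≼ (j , n)
  ≤⇒≼ j {m} {n} m≤n v≺u with <-cmp m n
  ... | tri< m<n _ _ = ≺-asym (<⇒≺ j m<n) v≺u
  ... | tri≈ _ refl _ = ≺-irrefl v≺u
  ... | tri> _ _ n<m = <⇒≱ n<m m≤n

  infixr 7 _⊙_
  _⊙_ : ℕ → Lin → Lin
  t ⊙ (j , m) = + t * j , + t * m

  multiple>𝟙 : ∀ {u} → 𝟘 ≺ u → ∃ λ t → 𝟙 ≺ t ⊙ u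
  -- Under the scaling of `ratPart` and `irrPart` the element 1 becomes 2a².
  multiple>𝟙 {j , m} 𝟘≺u with archimedean (+ 2 * (a * a)) 0<2a² (≺⇒positive 𝟘≺u)
  ... | t , P = t , positive⇒≺ (subst₂ Positive (rat a b (+ t) j m) (irr′ a (signℤ ε) (+ t) j) P)
    where
    rat : ∀ a b t j m → t * (a * (+ 2 * a * (m - + 0) - (j - + 0) * b)) - + 2 * (a * a) ≡
          a * (+ 2 * a * (t * m - + 1) - (t * j - + 0) * b)
    rat = solve-∀
    irr′ : ∀ a e t j → t * (a * (e * (j - + 0))) ≡ a * (e * (t * j - + 0))
    irr′ = solve-∀

  𝟘≺α : 𝟘 ≺ (+ 1 , + 0)
  𝟘≺α = <ᴸ⇒≺ α>0

  α≺𝟙 : (+ 1 , + 0) ≺ 𝟙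
  α≺𝟙 = <ᴸ⇒≺ α<1

  -- If j ≠ 0 no multiple of u = jα + m equals 1, so some s satisfies su < 1 < (s+1)u.
  straddle : ∀ {u} → proj₁ u ≢ + 0 → 𝟘 ≺ u → ∃ λ s → s ⊙ u ≺ 𝟙 × 𝟙 ≺ suc s ⊙ u
  straddle {u@(j , m)} j≢0 𝟘≺u = search (proj₁ (multiple>𝟙 𝟘≺u)) (proj₂ (multiple>𝟙 𝟘≺u))
    where
    s⊙u≢𝟙 : ∀ s → s ⊙ u ≢ 𝟙
    s⊙u≢𝟙 s eq with i*j≡0⇒i≡0∨j≡0 (+ s) (cong proj₁ eq)
    ... | inj₂ j≡0 = j≢0 j≡0
    s⊙u≢𝟙 zero eq | inj₁ _ with () ← cong proj₂ eq
    s⊙u≢𝟙 (suc s) eq | inj₁ ()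

    search : ∀ t → 𝟙 ≺ t ⊙ u → ∃ λ s → s ⊙ u ≺ 𝟙 × 𝟙 ≺ suc s ⊙ u
    search zero 𝟙≺𝟘 = ⊥-elim (≺-asym 𝟙≺𝟘 (<⇒≺ (+ 0) (+<+ (s≤s z≤n))))
    search (suc t) 𝟙≺ with ≺-cmp (t ⊙ u) 𝟙
    ... | inj₁ eq          = ⊥-elim (s⊙u≢𝟙 t eq)
    ... | inj₂ (inj₁ t⊙u≺) = t , t⊙u≺ , 𝟙≺
    ... | inj₂ (inj₂ 𝟙≺t⊙u) = search t 𝟙≺t⊙u

-- Gaps between the fractional parts

module Gaps (α : QuadIrr) (irr : IsQuadIrrIn01 α) where
  open QuadIrr α using (_≤ᴸ_; _<ᴸ_)
  open Order α irr
  open import Data.List.Relation.Unary.All using ([]; _∷_)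
  open import Data.List.Relation.Unary.AllPairs using ([]; _∷_)

  ≤ᴸ⇒≼ : ∀ u v → T (u ≤ᴸ v) → u ≼ v
  ≤ᴸ⇒≼ u v t (<ᴸ⇒≺ eq) with v <ᴸ u | eq | t
  ... | true | refl | ()

  ≼⇒≤ᴸ : ∀ u v → u ≼ v → T (u ≤ᴸ v)
  ≼⇒≤ᴸ u v u≼v with v <ᴸ u in eq
  ... | true  = ⊥-elim (u≼v (<ᴸ⇒≺ eq))
  ... | false = _

  ≰ᴸ⇒≻ : ∀ u v → ¬ T (u ≤ᴸ v) → v ≺ u
  ≰ᴸ⇒≻ u v ¬t with v <ᴸ u in eq
  ... | true  = <ᴸ⇒≺ eq
  ... | false = ⊥-elim (¬t _)

  -- Fractional parts

  frac′ : ℕ → Lin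
  frac′ = frac α

  𝟘≺𝟙 : 𝟘 ≺ 𝟙
  𝟘≺𝟙 = <⇒≺ (+ 0) (+<+ (s≤s z≤n))

  𝟘≼kα : ∀ k → 𝟘 ≼ (+ k , + 0)
  𝟘≼kα zero    = ≺-irrefl
  𝟘≼kα (suc k) = ≺-asym (≼-≺-trans (𝟘≼kα k) (≺-resp 𝟘≺α (id₁ (+ k)) refl))
    where
    id₁ : ∀ x → + 1 - + 0 ≡ (+ 1 + x) - x
    id₁ = solve-∀

  kα≺k+1 : ∀ k → (+ k , + 0) ≺ (+ 0 , + suc k)
  kα≺k+1 zero    = 𝟘≺𝟙
  kα≺k+1 (suc k) = ≺-sum (kα≺k+1 k) α≺𝟙 (id₁ (+ k)) (id₂ (+ k))
    where
    id₁ : ∀ x → (+ 0 - x) + (+ 0 - + 1) ≡ + 0 - (+ 1 + x)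
    id₁ = solve-∀
    id₂ : ∀ x → (+ 1 + x - + 0) + (+ 1 - + 0) ≡ + 1 + (+ 1 + x) - + 0
    id₂ = solve-∀

  floor-spec : ∀ k → let f = floorMul α k in
    (f ≡ 0 ⊎ T ((+ 0 , + f) ≤ᴸ (+ k , + 0))) × (f ≡ k ⊎ ¬ T ((+ 0 , + suc f) ≤ᴸ (+ k , + 0)))
  floor-spec k = count-down-closed (λ m → T? ((+ 0 , + m) ≤ᴸ (+ k , + 0))) closed k
    where
    closed : ∀ {m n} → m ℕ.≤ n → T ((+ 0 , + n) ≤ᴸ (+ k , + 0)) → T ((+ 0 , + m) ≤ᴸ (+ k , + 0))
    closed {m} {n} m≤n t = ≼⇒≤ᴸ (+ 0 , + m) (+ k , + 0)
      (≼-trans (≤⇒≼ (+ 0) (+≤+ m≤n)) (≤ᴸ⇒≼ (+ 0 , + n) (+ k , + 0) t))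

  𝟘≼frac : ∀ k → 𝟘 ≼ frac′ k
  𝟘≼frac k = lower (proj₁ (floor-spec k))
    where
    id₁ : ∀ x → + 0 - (- x) ≡ x - + 0
    id₁ = solve-∀
    lower : ∀ {f} → f ≡ 0 ⊎ T ((+ 0 , + f) ≤ᴸ (+ k , + 0)) → 𝟘 ≼ (+ k , - (+ f))
    lower (inj₁ refl) = 𝟘≼kα k
    lower {f} (inj₂ t) frac≺𝟘 = ≤ᴸ⇒≼ (+ 0 , + f) (+ k , + 0) t (≺-resp frac≺𝟘 refl (id₁ (+ f)))

  frac≺𝟙 : ∀ k → frac′ k ≺ 𝟙
  frac≺𝟙 k = upper (proj₂ (floor-spec k))
    where
    id₁ : ∀ x → (+ 1 + x) - + 0 ≡ + 1 - (- x)
    id₁ = solve-∀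
    upper : ∀ {f} → f ≡ k ⊎ ¬ T ((+ 0 , + suc f) ≤ᴸ (+ k , + 0)) → (+ k , - (+ f)) ≺ 𝟙
    -- The count stops at k, so for f = k the upper bound has to come from α < 1.
    upper (inj₁ refl) = ≺-resp (kα≺k+1 k) refl (id₁ (+ k))
    upper {f} (inj₂ ¬t) = ≺-resp (≰ᴸ⇒≻ (+ 0 , + suc f) (+ k , + 0) ¬t) refl (id₁ (+ f))

  unit-interval-≤ : ∀ {j m n} → (j , m) ≺ 𝟙 → 𝟘 ≼ (j , n) → m ≤ n
  unit-interval-≤ {j} {m} {n} u≺𝟙 𝟘≼v = ≮⇒≥ λ n<m →
    𝟘≼v (≼-≺-trans (≤⇒≼ j (i<j⇒i≤pred[j] n<m)) (≺-resp u≺𝟙 refl (id₁ m)))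
    where
    id₁ : ∀ m → + 1 - m ≡ + 0 - (- (+ 1) + m)
    id₁ = solve-∀

  -- Only one integer translate of kα lies in [0, 1). Fractional parts are thus identified by
  -- bounds, without computing a floor.
  frac-unique : ∀ {j m} k → j ≡ + k → 𝟘 ≼ (j , m) → (j , m) ≺ 𝟙 → frac′ k ≡ (j , m)
  frac-unique k refl 𝟘≼u u≺𝟙 = cong (+ k ,_)
    (≤-antisym (unit-interval-≤ (frac≺𝟙 k) 𝟘≼u) (unit-interval-≤ u≺𝟙 (𝟘≼frac k)))

  𝟘≺frac : ∀ {k} → 0 ℕ.< k → 𝟘 ≺ frac′ k
  𝟘≺frac {k} 0<k = ≼∧≢⇒≺ (𝟘≼frac k) λ eq → ℕₚ.<⇒≢ 0<k (+-injective (cong proj₁ eq))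

  -- For u = ⟨iα⟩ and su < 1 < (s+1)u, the element (s+1)u - 1 lies in (0, u) and has index (s+1)i.
  smaller-frac : ∀ i → 0 ℕ.< i → ∃ λ l → 0 ℕ.< l × frac′ l ≺ frac′ i
  smaller-frac i 0<i = from-straddle (straddle (λ eq → ℕₚ.<⇒≢ 0<i (sym (+-injective eq))) (𝟘≺frac 0<i))
    where
    m = proj₂ (frac′ i)
    id₁ : ∀ x → x - + 1 ≡ (x - + 1) - + 0
    id₁ = solve-∀
    id₂ : ∀ s i → + 0 - s * i ≡ i - (+ 1 + s) * i
    id₂ = solve-∀
    id₃ : ∀ s m → + 1 - s * m ≡ m - ((+ 1 + s) * m - + 1)
    id₃ = solve-∀
    from-straddle : (∃ λ s → s ⊙ frac′ i ≺ 𝟙 × 𝟙 ≺ suc s ⊙ frac′ i) → ∃ λ l → 0 ℕ.< l × frac′ l ≺ frac′ i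
    from-straddle (s , s⊙u≺𝟙 , 𝟙≺[1+s]⊙u) = suc s ℕ.* i , ℕₚ.≤-trans 0<i (ℕₚ.m≤m+n i (s ℕ.* i)) ,
      subst (_≺ frac′ i) (sym (frac-unique (suc s ℕ.* i) (sym (pos-* (suc s) i))
        (≺-asym 𝟘≺w) (≺-trans w≺u (frac≺𝟙 i)))) w≺u
      where
      w : Lin
      w = + suc s * + i , + suc s * m - + 1
      𝟘≺w : 𝟘 ≺ w
      𝟘≺w = ≺-resp 𝟙≺[1+s]⊙u refl (id₁ (+ suc s * m))
      w≺u : w ≺ frac′ i
      w≺u = ≺-resp s⊙u≺𝟙 (id₂ (+ s) (+ i)) (id₃ (+ s) m)

  -- The mirror image, with u = 1 - ⟨iα⟩: the element 2 - (s+1)u lies in (1 - u, 1) and again has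
  -- index (s+1)i.
  larger-frac : ∀ i → 0 ℕ.< i → ∃ λ l → 0 ℕ.< l × frac′ i ≺ frac′ l
  larger-frac i 0<i = from-straddle (straddle
      (λ eq → ℕₚ.<⇒≢ 0<i (+-injective (i-j≡0⇒i≡j (+ 0) (+ i) eq)))
      (≺-resp (frac≺𝟙 i) (id₀ (+ 0 - + i)) (id₀ (+ 1 - m))))
    where
    m = proj₂ (frac′ i)
    u : Lin
    u = + 0 - + i , + 1 - m
    id₀ : ∀ x → x ≡ x - + 0
    id₀ = solve-∀
    id₁ : ∀ x i → x * (+ 0 - i) - + 0 ≡ + 0 - x * i
    id₁ = solve-∀
    id₂ : ∀ x → x - + 1 ≡ + 1 - (+ 2 - x)
    id₂ = solve-∀
    id₃ : ∀ s i → + 0 - s * (+ 0 - i) ≡ (+ 1 + s) * i - i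
    id₃ = solve-∀
    id₄ : ∀ s m → + 1 - s * (+ 1 - m) ≡ (+ 2 - (+ 1 + s) * (+ 1 - m)) - m
    id₄ = solve-∀
    from-straddle : (∃ λ s → s ⊙ u ≺ 𝟙 × 𝟙 ≺ suc s ⊙ u) → ∃ λ l → 0 ℕ.< l × frac′ i ≺ frac′ l
    from-straddle (s , s⊙u≺𝟙 , 𝟙≺[1+s]⊙u) = suc s ℕ.* i , ℕₚ.≤-trans 0<i (ℕₚ.m≤m+n i (s ℕ.* i)) ,
      subst (frac′ i ≺_) (sym (frac-unique (suc s ℕ.* i) (sym (pos-* (suc s) i))
        (≺-asym (≼-≺-trans (𝟘≼frac i) v≺w)) w≺𝟙)) v≺w
      where
      w : Lin
      w = + suc s * + i , + 2 - + suc s * (+ 1 - m)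
      w≺𝟙 : w ≺ 𝟙
      w≺𝟙 = ≺-resp 𝟙≺[1+s]⊙u (id₁ (+ suc s) (+ i)) (id₂ (+ suc s * (+ 1 - m)))
      v≺w : frac′ i ≺ w
      v≺w = ≺-resp s⊙u≺𝟙 (id₃ (+ s) (+ i)) (id₄ (+ s) m)

  -- Such an i is neither the minimal nor the maximal index for any n ≥ N. The index l = 0 is
  -- excluded because ⟨0α⟩ = 0 lies below all the others.
  Beaten : ℕ → ℕ → Set
  Beaten N i = (∃ λ l → 0 ℕ.< l × l ℕ.< N × frac′ l ≺ frac′ i) × (∃ λ l → 0 ℕ.< l × l ℕ.< N × frac′ i ≺ frac′ l)

  beaten-mono : ∀ {M N i} → M ℕ.≤ N → Beaten M i → Beaten N i
  beaten-mono M≤N ((s , 0<s , s<M , s≺) , (t , 0<t , t<M , ≺t)) =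
    (s , 0<s , ℕₚ.≤-trans s<M M≤N , s≺) , (t , 0<t , ℕₚ.≤-trans t<M M≤N , ≺t)

  beaten : ∀ i → 0 ℕ.< i → ∃ λ N → Beaten N i
  beaten i 0<i = join (smaller-frac i 0<i) (larger-frac i 0<i)
    where
    join : (∃ λ l → 0 ℕ.< l × frac′ l ≺ frac′ i) → (∃ λ l → 0 ℕ.< l × frac′ i ≺ frac′ l) → ∃ λ N → Beaten N i
    join (s , 0<s , s≺) (t , 0<t , ≺t) = suc s ℕ.+ suc t ,
      (s , 0<s , ℕₚ.m≤m+n (suc s) (suc t) , s≺) , (t , 0<t , ℕₚ.m≤n+m (suc t) (suc s) , ≺t)

  all-beaten : ∀ K → ∃ λ N → ∀ i → 0 ℕ.< i → i ℕ.< K → Beaten N i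
  all-beaten zero          = 0 , λ _ _ ()
  all-beaten (suc zero)    = 0 , λ { _ (s≤s z≤n) (s≤s ()) }
  all-beaten (suc (suc k)) = extend (all-beaten (suc k)) (beaten (suc k) (s≤s z≤n))
    where
    extend : (∃ λ N → ∀ i → 0 ℕ.< i → i ℕ.< suc k → Beaten N i) → (∃ λ N → Beaten N (suc k)) →
             ∃ λ N → ∀ i → 0 ℕ.< i → i ℕ.< suc (suc k) → Beaten N i
    extend (M , below) (N , at) = M ℕ.+ N , λ i 0<i i<2+k →
      [ (λ i<1+k → beaten-mono (ℕₚ.m≤m+n M N) (below i 0<i i<1+k))
      , (λ i≡1+k → beaten-mono (ℕₚ.m≤n+m N M) (subst (Beaten N) (sym i≡1+k) at))
      ]′ (ℕₚ.m≤n⇒m<n∨m≡n (ℕ.s≤s⁻¹ i<2+k))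

  -- Sorting and adjacent elements

  insert-↭ : ∀ x ys → insert α x ys ↭ x ∷ ys
  insert-↭ x [] = ↭-refl
  insert-↭ x (y ∷ ys) with x ≤ᴸ y
  ... | true  = ↭-refl
  ... | false = ↭-trans (prep y (insert-↭ x ys)) (swap y x ↭-refl)

  sort-↭ : ∀ xs → sort α xs ↭ xs
  sort-↭ []       = ↭-refl
  sort-↭ (x ∷ xs) = ↭-trans (insert-↭ x (sort α xs)) (prep x (sort-↭ xs))

  insert-sorted : ∀ x {ys} → AllPairs _≼_ ys → AllPairs _≼_ (insert α x ys)
  insert-sorted x [] = [] ∷ []
  insert-sorted x {y ∷ ys} (y≼ys ∷ sorted) with x ≤ᴸ y in eq
  ... | true  = (x≼y ∷ All.map (≼-trans x≼y) y≼ys) ∷ y≼ys ∷ sorted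
    where
    x≼y : x ≼ y
    x≼y = ≤ᴸ⇒≼ x y (subst T (sym eq) _)
  ... | false = All-resp-↭ (↭-sym (insert-↭ x ys)) (≺-asym y≺x ∷ y≼ys) ∷ insert-sorted x sorted
    where
    y≺x : y ≺ x
    y≺x = ≰ᴸ⇒≻ x y (subst T eq)

  sort-sorted : ∀ xs → AllPairs _≼_ (sort α xs)
  sort-sorted []       = []
  sort-sorted (x ∷ xs) = insert-sorted x (sort-sorted xs)

  record Adjacent (xs : List Lin) (x y : Lin) : Set where
    field
      x∈xs    : x ∈ xs
      y∈xs    : y ∈ xs
      x≺y     : x ≺ y
      nothing-between : ∀ {z} → z ∈ xs → x ≺ z → y ≼ z
      gap     : y ⊖ x ∈ gapsOf α xs

  gap-there : ∀ {g} x xs → g ∈ gapsOf α xs → g ∈ gapsOf α (x ∷ xs)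
  gap-there x (y ∷ ys) g∈ = there g∈

  first-adjacent : ∀ {x y ys} → AllPairs _≼_ (x ∷ y ∷ ys) → x ≺ y → Adjacent (x ∷ y ∷ ys) x y
  first-adjacent (_ ∷ y≼ys ∷ _) x≺y = record
    { x∈xs = here refl ; y∈xs = there (here refl) ; x≺y = x≺y ; gap = here refl
    ; nothing-between = λ { (here refl) x≺x _ → ≺-irrefl x≺x
                          ; (there (here refl)) _ → ≺-irrefl
                          ; (there (there z∈ys)) _ → All.lookup y≼ys z∈ys } }

  adjacent-there : ∀ {u xs x y} → All (u ≼_) xs → Adjacent xs x y → Adjacent (u ∷ xs) x y
  adjacent-there {u} {xs} u≼xs adj = record
    { x∈xs = there x∈xs ; y∈xs = there y∈xs ; x≺y = x≺y ; gap = gap-there u xs gap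
    ; nothing-between = λ { (here refl) x≺u _ → All.lookup u≼xs x∈xs x≺u
                          ; (there z∈xs) x≺z → nothing-between z∈xs x≺z } }
    where open Adjacent adj

  -- The list is known to increase only weakly, so equal neighbours are passed over up to the last
  -- copy of x; the larger entry w ensures that something follows it.
  successor : ∀ {xs x w} → AllPairs _≼_ xs → x ∈ xs → w ∈ xs → x ≺ w → ∃ λ y → Adjacent xs x y
  successor (u≼us ∷ _) (there x∈us) (here refl) x≺w = ⊥-elim (All.lookup u≼us x∈us x≺w)
  successor (u≼us ∷ sorted) (there x∈us) (there w∈us) x≺w =
    map₂ (adjacent-there u≼us) (successor sorted x∈us w∈us x≺w)
  successor _ (here refl) (here refl) x≺w = ⊥-elim (≺-irrefl x≺w)
  successor {x ∷ y ∷ _} all@(x≼us@(x≼y ∷ _) ∷ sorted) (here refl) (there w∈us) x≺w =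
    [ (λ x≡y → map₂ (adjacent-there x≼us) (successor sorted (here x≡y) w∈us x≺w))
    , [ (λ x≺y → y , first-adjacent all x≺y) , (λ y≺x → ⊥-elim (x≼y y≺x)) ]′
    ]′ (≺-cmp x y)

  predecessor : ∀ {xs y w} → AllPairs _≼_ xs → y ∈ xs → w ∈ xs → w ≺ y → ∃ λ x → Adjacent xs x y
  predecessor _ (here refl) (here refl) w≺y = ⊥-elim (≺-irrefl w≺y)
  predecessor (u≼us ∷ _) (here refl) (there w∈us) w≺y = ⊥-elim (All.lookup u≼us w∈us w≺y)
  predecessor (u≼us ∷ sorted) (there y∈us) (there w∈us) w≺y =
    map₂ (adjacent-there u≼us) (predecessor sorted y∈us w∈us w≺y)
  predecessor {u ∷ _} all (there (here refl)) (here refl) w≺y = u , first-adjacent all w≺y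
  predecessor {u ∷ v ∷ _} {y} all@(u≼us ∷ sorted@(v≼us ∷ _)) (there y∈vus@(there y∈us)) (here refl) w≺y =
    [ (λ v≡y → u , subst (Adjacent _ u) v≡y (first-adjacent all (subst (u ≺_) (sym v≡y) w≺y)))
    , [ (λ v≺y → map₂ (adjacent-there u≼us) (predecessor sorted y∈vus (here refl) v≺y))
      , (λ y≺v → ⊥-elim (All.lookup v≼us y∈us y≺v)) ]′
    ]′ (≺-cmp v y)

  sorted-points : ℕ → List Lin
  sorted-points n = sort α (points α n)

  𝟙∈ : ∀ n → 𝟙 ∈ sorted-points n
  𝟙∈ n = ∈-resp-↭ (↭-sym (sort-↭ (points α n))) (∈-++⁺ʳ (map frac′ (upTo n)) (here refl))

  frac∈ : ∀ {i n} → i ℕ.< n → frac′ i ∈ sorted-points n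
  frac∈ {i} {n} i<n = ∈-resp-↭ (↭-sym (sort-↭ (points α n))) (∈-++⁺ˡ (∈-map⁺ frac′ (∈-upTo⁺ i<n)))

  point-cases : ∀ {n z} → z ∈ sorted-points n → (∃ λ i → i ℕ.< n × z ≡ frac′ i) ⊎ z ≡ 𝟙
  point-cases {n} {z} z∈ =
    [ inj₁ ∘ from-map ∘ ∈-map⁻ frac′ , (λ { (here z≡𝟙) → inj₂ z≡𝟙 }) ]′
    (∈-++⁻ (map frac′ (upTo n)) (∈-resp-↭ (sort-↭ (points α n)) z∈))
    where
    from-map : (∃ λ i → i ∈ upTo n × z ≡ frac′ i) → ∃ λ i → i ℕ.< n × z ≡ frac′ i
    from-map (i , i∈ , z≡) = i , ∈-upTo⁻ i∈ , z≡

  -- Extremal indices and n = p + q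

  record Extremal (n p q : ℕ) : Set where
    field
      0<p : 0 ℕ.< p
      p<n : p ℕ.< n
      0<q : 0 ℕ.< q
      q<n : q ℕ.< n
      minimal : ∀ {i} → 0 ℕ.< i → i ℕ.< n → frac′ p ≼ frac′ i
      maximal : ∀ {i} → 0 ℕ.< i → i ℕ.< n → frac′ i ≼ frac′ q

  -- Otherwise one of ⟨pα⟩ + ⟨qα⟩ − 1 and ⟨pα⟩ + ⟨qα⟩ would be ⟨(p+q)α⟩,
  -- lying below ⟨pα⟩ or above ⟨qα⟩.
  extremal⇒n≤p+q : ∀ {n p q} → Extremal n p q → n ℕ.≤ p ℕ.+ q
  extremal⇒n≤p+q {n} {p} {q} ext = ℕₚ.≮⇒≥ λ p+q<n → by-cmp p+q<n (≺-cmp w 𝟘)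
    where
    open Extremal ext
    mp = proj₂ (frac′ p)
    mq = proj₂ (frac′ q)
    w w+1 : Lin
    w   = + (p ℕ.+ q) , mp + mq - + 1
    w+1 = + (p ℕ.+ q) , mp + mq
    0<p+q : 0 ℕ.< p ℕ.+ q
    0<p+q = ℕₚ.≤-trans 0<p (ℕₚ.m≤m+n p q)
    id₁ : ∀ x y → + 0 - x ≡ y - (y + x)
    id₁ = solve-∀
    id₂ : ∀ x y → + 1 - x ≡ y - (y + x - + 1)
    id₂ = solve-∀
    id₃ : ∀ x y → x - + 0 ≡ (x + y) - y
    id₃ = solve-∀
    id₄ : ∀ x y → + 0 - (x + y - + 1) ≡ + 1 - (x + y)
    id₄ = solve-∀
    w≺p : w ≺ frac′ p
    w≺p = ≺-resp (frac≺𝟙 q) (id₁ (+ q) (+ p)) (id₂ mq mp)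
    q≺w+1 : frac′ q ≺ w+1
    q≺w+1 = ≺-resp (𝟘≺frac 0<p) (id₃ (+ p) (+ q)) (id₃ mp mq)
    small : p ℕ.+ q ℕ.< n → 𝟘 ≼ w → ⊥
    small p+q<n 𝟘≼w = minimal 0<p+q p+q<n
      (subst (_≺ frac′ p) (sym (frac-unique (p ℕ.+ q) refl 𝟘≼w (≺-trans w≺p (frac≺𝟙 p)))) w≺p)
    by-cmp : p ℕ.+ q ℕ.< n → w ≡ 𝟘 ⊎ w ≺ 𝟘 ⊎ 𝟘 ≺ w → ⊥
    by-cmp p+q<n (inj₁ w≡𝟘) = ℕₚ.<⇒≢ 0<p+q (sym (+-injective (cong proj₁ w≡𝟘)))
    by-cmp p+q<n (inj₂ (inj₂ 𝟘≺w)) = small p+q<n (≺-asym 𝟘≺w)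
    by-cmp p+q<n (inj₂ (inj₁ w≺𝟘)) = maximal 0<p+q p+q<n
      (subst (frac′ q ≺_) (sym (frac-unique (p ℕ.+ q) refl
        (≺-asym (≼-≺-trans (𝟘≼frac q) q≺w+1)) (≺-resp w≺𝟘 refl (id₄ mp mq)))) q≺w+1)

  -- Both extreme gaps A = ⟨pα⟩ and B = 1 − ⟨qα⟩ occur, with index differences p and −q.
  -- The gap to the right of ⟨(q−1)α⟩ cannot be B, as indices are nonnegative, so it leads
  -- to the point with index p + q − 1.
  two-gaps : ∀ {n} → 2 ℕ.≤ n → #Δ α n ≡ 2 → ∃₂ λ p q → Extremal n p q × n ≡ p ℕ.+ q
  two-gaps {n} 2≤n #Δ≡2 = by-ends
      (successor sorted (frac∈ 0<n) (𝟙∈ n) 𝟘≺𝟙) (predecessor sorted (𝟙∈ n) (frac∈ 0<n) 𝟘≺𝟙)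
    where
    sorted = sort-sorted (points α n)
    0<n : 0 ℕ.< n
    0<n = ℕₚ.≤-trans (s≤s z≤n) 2≤n

    p+q≤n : ∀ {p q} → 0 ℕ.< p → 0 ℕ.< q → q ℕ.< n →
            Adjacent (sorted-points n) 𝟘 (frac′ p) → Adjacent (sorted-points n) (frac′ q) 𝟙 → p ℕ.+ q ℕ.≤ n
    -- From here `q` is one less than the maximal index, so the bound to be reached is p + suc q ≤
    -- n.
    p+q≤n {p} {suc q} 0<p 0<q q<n adjA adjB = from-next
        (successor sorted (frac∈ {q} (ℕₚ.<-trans ℕₚ.≤-refl q<n)) (𝟙∈ n) (frac≺𝟙 q))
      where
      cross-≡ : ∀ {x y z w} → x - y ≡ z - w → x + w ≡ z + y
      cross-≡ {x} {y} {z} {w} eq = trans (id₁ x y w) (trans (cong (_+ (y + w)) eq) (id₂ y z w))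
        where
        id₁ : ∀ x y w → x + w ≡ (x - y) + (y + w)
        id₁ = solve-∀
        id₂ : ∀ y z w → (z - w) + (y + w) ≡ z + y
        id₂ = solve-∀
      A B : Lin
      A = frac′ p ⊖ 𝟘
      B = 𝟙 ⊖ frac′ (suc q)
      ∈Δ : ∀ {g} → g ∈ gapsOf α (sorted-points n) → g ∈ Δ α n
      ∈Δ = ∈-deduplicate⁺ (≡-dec _≟_ _≟_)
      A≢B : A ≢ B
      A≢B A≡B = ℕₚ.<⇒≢ (ℕₚ.≤-trans 0<p (ℕₚ.m≤m+n p (suc q)))
        (sym (+-injective (cross-≡ {+ p} {+ 0} {+ 0} {+ suc q} (cong proj₁ A≡B))))
      -- The endpoint 1 has index 0, so it obeys the same bound as the fractional parts.
      index : ∀ {z} → z ∈ sorted-points n → ∃ λ i → i ℕ.< n × proj₁ z ≡ + i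
      index z∈ = [ (λ { (i , i<n , z≡) → i , i<n , cong proj₁ z≡ }) , (λ z≡𝟙 → 0 , 0<n , cong proj₁ z≡𝟙) ]′
                 (point-cases z∈)
      from-gap : ∀ {z} → (∃ λ i → i ℕ.< n × proj₁ z ≡ + i) → z ⊖ frac′ q ≡ A ⊎ z ⊖ frac′ q ≡ B →
                 p ℕ.+ suc q ℕ.≤ n
      from-gap (i , i<n , refl) (inj₁ g≡A) = subst (ℕ._≤ n) (begin
        suc i          ≡⟨ cong suc (sym (ℕₚ.+-identityʳ i)) ⟩
        suc (i ℕ.+ 0)  ≡⟨ cong suc (+-injective (cross-≡ {+ i} {+ q} {+ p} {+ 0} (cong proj₁ g≡A))) ⟩
        suc (p ℕ.+ q)  ≡⟨ sym (ℕₚ.+-suc p q) ⟩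
        p ℕ.+ suc q    ∎) i<n
        where open ≡-Reasoning
      from-gap (i , i<n , refl) (inj₂ g≡B) = ⊥-elim (ℕₚ.<⇒≢ (ℕₚ.m≤n+m (suc q) i)
        (sym (+-injective (cross-≡ {+ i} {+ q} {+ 0} {+ suc q} (cong proj₁ g≡B)))))
      from-next : (∃ λ z → Adjacent (sorted-points n) (frac′ q) z) → p ℕ.+ suc q ℕ.≤ n
      from-next (z , adj) = from-gap {z} (index (Adjacent.y∈xs adj))
        (two-elements #Δ≡2 (∈Δ (Adjacent.gap adjA)) (∈Δ (Adjacent.gap adjB)) A≢B (∈Δ (Adjacent.gap adj)))

    from-indices : ∀ {p q} → p ℕ.< n → q ℕ.< n → Adjacent (sorted-points n) 𝟘 (frac′ p) →
                   Adjacent (sorted-points n) (frac′ q) 𝟙 → ∃₂ λ p q → Extremal n p q × n ≡ p ℕ.+ q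
    from-indices {p} {q} p<n q<n adjA adjB =
      p , q , ext , ℕₚ.≤-antisym (extremal⇒n≤p+q ext) (p+q≤n 0<p 0<q q<n adjA adjB)
      where
      0<p : 0 ℕ.< p
      0<p = ℕₚ.n≢0⇒n>0 λ p≡0 → ≺-irrefl (subst (λ i → 𝟘 ≺ frac′ i) p≡0 (Adjacent.x≺y adjA))
      -- If q were 0, the point ⟨1α⟩, present because n ≥ 2, would lie inside the last gap.
      0<q : 0 ℕ.< q
      0<q = ℕₚ.n≢0⇒n>0 λ q≡0 → Adjacent.nothing-between adjB (frac∈ 2≤n)
        (subst (λ i → frac′ i ≺ frac′ 1) (sym q≡0) (𝟘≺frac (s≤s z≤n))) (frac≺𝟙 1)
      ext : Extremal n p q
      ext = record { 0<p = 0<p ; p<n = p<n ; 0<q = 0<q ; q<n = q<n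
        ; minimal = λ 0<i i<n → Adjacent.nothing-between adjA (frac∈ i<n) (𝟘≺frac 0<i)
        ; maximal = λ {i} 0<i i<n q≺i → Adjacent.nothing-between adjB (frac∈ i<n) q≺i (frac≺𝟙 i) }

    by-ends : (∃ λ y → Adjacent (sorted-points n) 𝟘 y) → (∃ λ x → Adjacent (sorted-points n) x 𝟙) →
              ∃₂ λ p q → Extremal n p q × n ≡ p ℕ.+ q
    by-ends (y , adjA) (x , adjB) =
      from-points (point-cases (Adjacent.y∈xs adjA)) (point-cases (Adjacent.x∈xs adjB))
      where
      from-points : (∃ λ i → i ℕ.< n × y ≡ frac′ i) ⊎ y ≡ 𝟙 → (∃ λ i → i ℕ.< n × x ≡ frac′ i) ⊎ x ≡ 𝟙 →
                    ∃₂ λ p q → Extremal n p q × n ≡ p ℕ.+ q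
      from-points (inj₂ y≡𝟙) _ = ⊥-elim (Adjacent.nothing-between adjA (frac∈ 2≤n) (𝟘≺frac (s≤s z≤n))
        (subst (frac′ 1 ≺_) (sym y≡𝟙) (frac≺𝟙 1)))
      from-points (inj₁ _) (inj₂ x≡𝟙) = ⊥-elim (≺-irrefl (subst (_≺ 𝟙) x≡𝟙 (Adjacent.x≺y adjB)))
      from-points (inj₁ (p , p<n , y≡)) (inj₁ (q , q<n , x≡)) = from-indices p<n q<n
        (subst (Adjacent _ 𝟘) y≡ adjA) (subst (λ x → Adjacent _ x 𝟙) x≡ adjB)

  -- Spacing of the two-gap values

  frac-injective : ∀ {i j} → frac′ i ≡ frac′ j → i ≡ j
  frac-injective eq = +-injective (cong proj₁ eq)

  -- A new extremal index below n already competed at stage n, so each of the two points bounds the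
  -- other and they coincide.
  extremal-mono : ∀ {n n′ p q p′ q′} → n ℕ.< n′ → Extremal n p q → Extremal n′ p′ q′ →
                  (p′ ≡ p ⊎ n ℕ.≤ p′) × (q′ ≡ q ⊎ n ℕ.≤ q′)
  extremal-mono {n} {n′} {p} {q} {p′} {q′} n<n′ ext ext′ =
    p-case (ℕₚ.<-≤-connex p′ n) , q-case (ℕₚ.<-≤-connex q′ n)
    where
    open Extremal
    p-case : p′ ℕ.< n ⊎ n ℕ.≤ p′ → p′ ≡ p ⊎ n ℕ.≤ p′
    p-case (inj₂ n≤p′) = inj₂ n≤p′
    p-case (inj₁ p′<n) = inj₁ (frac-injective (≼-antisym
      (minimal ext′ (0<p ext) (ℕₚ.<-trans (p<n ext) n<n′)) (minimal ext (0<p ext′) p′<n)))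
    q-case : q′ ℕ.< n ⊎ n ℕ.≤ q′ → q′ ≡ q ⊎ n ℕ.≤ q′
    q-case (inj₂ n≤q′) = inj₂ n≤q′
    q-case (inj₁ q′<n) = inj₁ (frac-injective (≼-antisym
      (maximal ext (0<q ext′) q′<n) (maximal ext′ (0<q ext) (ℕₚ.<-trans (q<n ext) n<n′))))

  extremal-unbounded : ∀ K → ∃ λ N → ∀ {n p q} → N ℕ.≤ n → Extremal n p q → K ℕ.≤ p × K ℕ.≤ q
  extremal-unbounded K = proj₁ (all-beaten K) , λ N≤n ext → let open Extremal ext in
      ℕₚ.≮⇒≥ (λ p<K → let l , 0<l , l<N , l≺p = proj₁ (proj₂ (all-beaten K) _ 0<p p<K) in
        minimal 0<l (ℕₚ.≤-trans l<N N≤n) l≺p) ,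
      ℕₚ.≮⇒≥ (λ q<K → let l , 0<l , l<N , q≺l = proj₂ (proj₂ (all-beaten K) _ 0<q q<K) in
        maximal 0<l (ℕₚ.≤-trans l<N N≤n) q≺l)

  two-gaps-sparse : ∀ K → ∃ λ N → ∀ {m n} → N ℕ.≤ m → m ℕ.< n → #Δ α m ≡ 2 → #Δ α n ≡ 2 → m ℕ.+ K ℕ.≤ n
  two-gaps-sparse K = 2 ℕ.+ N , λ 2+N≤m m<n Δm Δn →
      sparse (ℕₚ.m+n≤o⇒n≤o 2 2+N≤m) m<n
        (two-gaps (ℕₚ.m+n≤o⇒m≤o 2 2+N≤m) Δm)
        (two-gaps (ℕₚ.≤-trans (ℕₚ.m+n≤o⇒m≤o 2 2+N≤m) (ℕₚ.<⇒≤ m<n)) Δn)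
    where
    N = proj₁ (extremal-unbounded K)

    separate : ∀ {m n p q p′ q′} → m ℕ.< n → m ≡ p ℕ.+ q → n ≡ p′ ℕ.+ q′ →
               (p′ ≡ p ⊎ m ℕ.≤ p′) × (q′ ≡ q ⊎ m ℕ.≤ q′) → K ℕ.≤ p′ × K ℕ.≤ q′ → m ℕ.+ K ℕ.≤ n
    separate _ _ refl (inj₂ m≤p′ , _) (_ , K≤q′) = ℕₚ.+-mono-≤ m≤p′ K≤q′
    separate {m} {n} _ _ refl (inj₁ _ , inj₂ m≤q′) (K≤p′ , _) =
      subst (ℕ._≤ n) (ℕₚ.+-comm K m) (ℕₚ.+-mono-≤ K≤p′ m≤q′)
    -- If neither index moved, the two sums p + q would agree, contrary to m < n.
    separate m<n refl refl (inj₁ refl , inj₁ refl) _ = ⊥-elim (ℕₚ.<-irrefl refl m<n)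

    sparse : ∀ {m n} → N ℕ.≤ m → m ℕ.< n → (∃₂ λ p q → Extremal m p q × m ≡ p ℕ.+ q) →
             (∃₂ λ p q → Extremal n p q × n ≡ p ℕ.+ q) → m ℕ.+ K ℕ.≤ n
    sparse N≤m m<n (p , q , ext , m≡) (p′ , q′ , ext′ , n≡) = separate m<n m≡ n≡
      (extremal-mono m<n ext ext′) (proj₂ (extremal-unbounded K) (ℕₚ.≤-trans N≤m (ℕₚ.<⇒≤ m<n)) ext′)

theorem8 : (α : QuadIrr) → IsQuadIrrIn01 α →
    (k : ℕ) → ∃ λ N₀ → (N : ℕ) → N₀ ℕ.≤ N →
    suc k ℕ.* twoGapCount α N ℕ.< N
theorem8 α irr k = suc (K ℕ.* suc N₁) , λ N N₀≤N → ℕₚ.*-cancelˡ-< 2 _ _ (begin-strict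
    2 ℕ.* (suc k ℕ.* twoGapCount α N)  ≡⟨ sym (ℕₚ.*-assoc 2 (suc k) (twoGapCount α N)) ⟩
    K ℕ.* twoGapCount α N              ≤⟨ count-sparse (λ n → #Δ α n ℕ.≟ 2) K N₁ (proj₂ sparse) N ⟩
    N ℕ.+ K ℕ.* suc N₁                 <⟨ ℕₚ.+-monoʳ-< N N₀≤N ⟩
    N ℕ.+ N                            ≡⟨ cong (N ℕ.+_) (sym (ℕₚ.+-identityʳ N)) ⟩
    2 ℕ.* N                            ∎)
  where
  open ℕₚ.≤-Reasoning
  -- The factor 2 absorbs the additive constant of `count-sparse`: K(N₁ + 1) < N for N ≥ N₀, so
  -- 2(k+1) times the count is below 2N.
  K = 2 ℕ.* suc k
  sparse = Gaps.two-gaps-sparse α irr K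
  N₁ = proj₁ sparse
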